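{- Let $k\equiv\pm1,\pm3\pmod{10}$. Then $\operatorname{Ker}\nu_{G^k}=\{M=\begin{pmatrix} a&b\\ c&d\end{pmatrix}\in\Gamma_{\theta,5}: b,c\in5\mathbb{Z}\text{ and }\tfrac b5\equiv\tfrac c5\pmod5\}$; in particular $\operatorname{Ker}\nu_{G^k}=\operatorname{Ker}\nu_{F^k}$.
   Context: $\Gamma_{\theta,5}=\{M\in SL(2,\mathbb{Z}): M\equiv\pm\begin{pmatrix}1&0\\0&1\end{pmatrix}\text{ or }\pm\begin{pmatrix}0&-1\\1&0\end{pmatrix}\pmod 5\}$. For $M=\begin{pmatrix} a&b\\ c&d\end{pmatrix}\in\Gamma_{\theta,5}$ define $g(M)=\frac{6b}{5}+\frac{2ab}{5}+\frac{2cd}{5}$ if $M\equiv I$, $\frac{24b}{5}+\frac{2ab}{5}+\frac{2cd}{5}$ if $M\equiv -I$, $5+\frac{6d}{5}+\frac{2ab}{5}+\frac{2cd}{5}$ if $M\equiv\begin{pmatrix}0&-1\\1&0\end{pmatrix}$, $5-\frac{6d}{5}+\frac{2ab}{5}+\frac{2cd}{5}$ if $M\equiv\begin{pmatrix}0&1\\-1&0\end{pmatrix}$ (all mod 5), and $f(M)$ by the same case split with values $\frac{4b}{5}+\frac{8ab}{5}+\frac{8cd}{5}$, $\frac{6b}{5}+\frac{8ab}{5}+\frac{8cd}{5}$, $5+\frac{4d}{5}+\frac{8ab}{5}+\frac{8cd}{5}$, $5-\frac{4d}{5}+\frac{8ab}{5}+\frac{8cd}{5}$ respectively. For $k\in\mathbb{Z}$,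 $\nu_{G^k}(M)=\exp(\frac{\pi ik}{5}g(M))$ and $\nu_{F^k}(M)=\exp(\frac{\pi ik}{5}f(M))$; these are the multiplier systems (weight $2k$) of $G^k$ and $F^k$, where $G=\eta^6/\big(\theta\begin{bmatrix}3/5\\3/5\end{bmatrix}\theta\begin{bmatrix}3/5\\7/5\end{bmatrix}\big)$, $F=\eta^6/\big(\theta\begin{bmatrix}1/5\\1/5\end{bmatrix}\theta\begin{bmatrix}1/5\\9/5\end{bmatrix}\big)$, with theta constants $\theta\begin{bmatrix}\epsilon\\ \epsilon'\end{bmatrix}=\sum_{n\in\mathbb{Z}}\exp(2\pi i[\frac12(n+\frac\epsilon2)^2\tau+(n+\frac\epsilon2)\frac{\epsilon'}2])$ and $\eta(\tau)=q^{1/24}\prod_{n\ge1}(1-q^n)$. Kernels are $\{M\in\Gamma_{\theta,5}:\nu(M)=1\}$. -}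

module Defs where

open import Level using (suc; _⊔_)
open import Algebra.Apartness.Bundles using (HeytingField)
open import Algebra.Bundles using (CommutativeRing)
open import Algebra.Morphism.Structures using (IsRingMonomorphism; IsMonoidHomomorphism)
open import Data.Integer using (ℤ; +_; 0ℤ; 1ℤ; -1ℤ) renaming (_*_ to _*ᶻ_; _-_ to _-ᶻ_)
open import Data.Integer.Divisibility.Signed using (_∣_; quotient)
open import Data.Product using (Σ-syntax; ∃-syntax; _×_)
open import Data.Rational using (ℚ; _/_; +-*-rawRing) renaming (_+_ to _+ᑫ_; _-_ to _-ᑫ_)
open import Function.Bundles using (_⇔_)
open import Relation.Binary.PropositionalEquality using (_≡_; refl)
open import Relation.Unary using (Pred)

-- The complex numbers enter only through the structure below, of which ℂ with
-- its usual exponential, π and i is an instance: a (constructive) field of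
-- characteristic 0 with a square root i of -1, a nonzero number π, and a
-- homomorphism exp from the additive to the multiplicative monoid whose kernel
-- is exactly 2πiℤ.  A ring homomorphism out of ℚ is unique if it exists, so ι
-- is no extra choice; its injectivity is automatic in a nontrivial ring.
record ComplexExponential c ℓ₁ ℓ₂ : Set (suc (c ⊔ ℓ₁ ⊔ ℓ₂)) where
  field
    heytingField : HeytingField c ℓ₁ ℓ₂

  open HeytingField heytingField public

  commutativeRing : CommutativeRing c ℓ₁
  commutativeRing = record { isCommutativeRing = isCommutativeRing }

  private module R = CommutativeRing commutativeRing

  field
    ι   : ℚ → Carrier
    i   : Carrier
    π   : Carrier
    exp : Carrier → Carrier

    ι-isRingMonomorphism      : IsRingMonomorphism +-*-rawRing R.rawRing ι
    i²≈-1                     : i * i ≈ - 1#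
    π#0                       : π # 0#
    exp-isMonoidHomomorphism  : IsMonoidHomomorphism R.+-rawMonoid R.*-rawMonoid exp
    exp≈1⇔                    : ∀ z → (exp z ≈ 1#) ⇔ (∃[ n ] z ≈ ι (((+ 2) *ᶻ n) / 1) * (π * i))

infix 4 _≡_[mod_]
_≡_[mod_] : ℤ → ℤ → ℤ → Set
x ≡ y [mod n ] = n ∣ x -ᶻ y

-- The matrix ( a b ; c d ).
record SL₂ℤ : Set where
  constructor mat
  field
    a b c d : ℤ
    det≡1   : (a *ᶻ d) -ᶻ (b *ᶻ c) ≡ 1ℤ

I -I S -S : SL₂ℤ
I  = mat 1ℤ  0ℤ  0ℤ  1ℤ  refl
-I = mat -1ℤ 0ℤ  0ℤ  -1ℤ refl
S  = mat 0ℤ  -1ℤ 1ℤ  0ℤ  refl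
-S = mat 0ℤ  1ℤ  -1ℤ 0ℤ  refl

infix 4 _≅_[mod_]
_≅_[mod_] : SL₂ℤ → SL₂ℤ → ℤ → Set
M ≅ N [mod n ] =
  (M.a ≡ N.a [mod n ]) × (M.b ≡ N.b [mod n ]) × (M.c ≡ N.c [mod n ]) × (M.d ≡ N.d [mod n ])
  where
  module M = SL₂ℤ M
  module N = SL₂ℤ N

-- The four classes are pairwise disjoint, so the case splits in g and f below
-- depend on the matrix only.
data ∈Γθ5 (M : SL₂ℤ) : Set where
  ≡I  : M ≅ I  [mod + 5 ] → ∈Γθ5 M
  ≡-I : M ≅ -I [mod + 5 ] → ∈Γθ5 M
  ≡S  : M ≅ S  [mod + 5 ] → ∈Γθ5 M
  ≡-S : M ≅ -S [mod + 5 ] → ∈Γθ5 M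

record Γθ5 : Set where
  constructor _,_
  field
    matrix : SL₂ℤ
    member : ∈Γθ5 matrix
  open SL₂ℤ matrix public

g : Γθ5 → ℚ
g (mat a b c d _ , ≡I  _) =
  ((+ 6 *ᶻ b) / 5) +ᑫ ((+ 2 *ᶻ a *ᶻ b) / 5) +ᑫ ((+ 2 *ᶻ c *ᶻ d) / 5)
g (mat a b c d _ , ≡-I _) =
  ((+ 24 *ᶻ b) / 5) +ᑫ ((+ 2 *ᶻ a *ᶻ b) / 5) +ᑫ ((+ 2 *ᶻ c *ᶻ d) / 5)
g (mat a b c d _ , ≡S  _) =
  (+ 5 / 1) +ᑫ ((+ 6 *ᶻ d) / 5) +ᑫ ((+ 2 *ᶻ a *ᶻ b) / 5) +ᑫ ((+ 2 *ᶻ c *ᶻ d) / 5)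
g (mat a b c d _ , ≡-S _) =
  (+ 5 / 1) -ᑫ ((+ 6 *ᶻ d) / 5) +ᑫ ((+ 2 *ᶻ a *ᶻ b) / 5) +ᑫ ((+ 2 *ᶻ c *ᶻ d) / 5)

f : Γθ5 → ℚ
f (mat a b c d _ , ≡I  _) =
  ((+ 4 *ᶻ b) / 5) +ᑫ ((+ 8 *ᶻ a *ᶻ b) / 5) +ᑫ ((+ 8 *ᶻ c *ᶻ d) / 5)
f (mat a b c d _ , ≡-I _) =
  ((+ 6 *ᶻ b) / 5) +ᑫ ((+ 8 *ᶻ a *ᶻ b) / 5) +ᑫ ((+ 8 *ᶻ c *ᶻ d) / 5)
f (mat a b c d _ , ≡S  _) =
  (+ 5 / 1) +ᑫ ((+ 4 *ᶻ d) / 5) +ᑫ ((+ 8 *ᶻ a *ᶻ b) / 5) +ᑫ ((+ 8 *ᶻ c *ᶻ d) / 5)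
f (mat a b c d _ , ≡-S _) =
  (+ 5 / 1) -ᑫ ((+ 4 *ᶻ d) / 5) +ᑫ ((+ 8 *ᶻ a *ᶻ b) / 5) +ᑫ ((+ 8 *ᶻ c *ᶻ d) / 5)

module Multiplier {c ℓ₁ ℓ₂} (ℂ : ComplexExponential c ℓ₁ ℓ₂) where
  open ComplexExponential ℂ

  νG^ : ℤ → Γθ5 → Carrier
  νG^ k M = exp (π * i * ι (k / 5) * ι (g M))

  νF^ : ℤ → Γθ5 → Carrier
  νF^ k M = exp (π * i * ι (k / 5) * ι (f M))

  Ker : (Γθ5 → Carrier) → Pred Γθ5 ℓ₁
  Ker ν M = ν M ≈ 1#

-- b, c ∈ 5ℤ and b/5 ≡ c/5 (mod 5); the quotient of a proof of 5 ∣ b is b/5.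
b/5≡c/5 : Pred Γθ5 _
b/5≡c/5 M =
  Σ[ 5∣b ∈ + 5 ∣ b ] Σ[ 5∣c ∈ + 5 ∣ c ] quotient 5∣b ≡ quotient 5∣c [mod + 5 ]
  where open Γθ5 M

{-# OPTIONS --safe #-}

-- Write g(M) = N/5 with N ∈ ℤ.  Then exp(πi (k/5) g(M)) = 1 says 50 ∣ k N, and
-- k is a unit modulo 50, so the kernel is given by 50 ∣ N, whatever k is.  If
-- M ≡ ±S then N is odd, while 5 ∤ b.  If M ≡ ε I with ε = ±1, then
-- N = 2rb + 2s(ab + cd) with r + 2sε ≡ 0 (mod 5), whence
-- N ≡ 10sε(c/5 - b/5) (mod 50), where sε is a unit modulo 5.  The same holds
-- for f with other values of r and s.
module Submission where

open import Defs
import Algebra.Apartness.Properties.HeytingCommutativeRing as HeytingProperties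
open import Algebra.Bundles using (CommutativeRing)
open import Algebra.Morphism.Structures using (IsRingMonomorphism)
import Algebra.Properties.Ring as RingProperties
open import Data.Integer using (ℤ; +_; -_; _+_; _*_; _-_; 1ℤ; -1ℤ)
open import Data.Integer.Divisibility.Signed
open import Data.Integer.Properties using (+-identityʳ; *-identityʳ)
open import Data.Integer.Tactic.RingSolver using (solve-∀)
open import Data.Product using (_×_; _,_; ∃-syntax)
open import Data.Rational as ℚ using (_/_)
import Data.Rational.Properties as ℚ
open import Data.Rational.Unnormalised as ℚᵘ using (mkℚᵘ; *≡*)
import Data.Rational.Unnormalised.Properties as ℚᵘ
open import Data.Sum using (_⊎_; inj₁; inj₂)
open import Function.Base using (_$_)
open import Function.Bundles using (_⇔_; mk⇔; module Equivalence)
open import Function.Construct.Composition renaming (_⇔-∘_ to infixr 8 _⇔-∘_) using ()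
open import Function.Construct.Symmetry using (⇔-sym)
import Relation.Binary.Reasoning.Setoid as SetoidReasoning
open import Relation.Binary.PropositionalEquality
  using (_≡_; refl; sym; trans; cong; cong₂; subst; module ≡-Reasoning)
open import Relation.Nullary using (¬_; contradiction)
open import Relation.Nullary.Decidable using (from-no)
open import Relation.Unary using (Pred; _≐_)

-- Divisibility of integers

∣-difference⇒⇔ : ∀ {n} x y → n ∣ x - y → n ∣ x ⇔ n ∣ y
∣-difference⇒⇔ {n} x y n∣x-y = mk⇔
  (λ n∣x → subst (n ∣_) (x-[x-y]≡y x y) (∣m∣n⇒∣m-n n∣x n∣x-y))
  (λ n∣y → subst (n ∣_) ([x-y]+y≡x x y) (∣m∣n⇒∣m+n n∣x-y n∣y))
  where
  x-[x-y]≡y : ∀ x y → x - (x - y) ≡ y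
  x-[x-y]≡y = solve-∀
  [x-y]+y≡x : ∀ x y → (x - y) + y ≡ x
  [x-y]+y≡x = solve-∀

-- Multiplying by the inverse `u` turns `v * x` into `u * (v * x)`, which differs from `x` by the
-- multiple `(u * v - 1ℤ) * x` of `n`.
unit⇒∣-*⇔ : ∀ {n} u v → u * v ≡ 1ℤ [mod n ] → ∀ x → n ∣ v * x ⇔ n ∣ x
unit⇒∣-*⇔ {n} u v uv≡1 x = mk⇔
  (λ n∣vx → Equivalence.to (∣-difference⇒⇔ (u * (v * x)) x n∣uvx-x) (∣n⇒∣m*n u n∣vx))
  (∣n⇒∣m*n v)
  where
  factor : ∀ u v x → (u * v - 1ℤ) * x ≡ u * (v * x) - x
  factor = solve-∀
  n∣uvx-x : n ∣ u * (v * x) - x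
  n∣uvx-x = subst (n ∣_) (factor u v x) (∣m⇒∣m*n x uv≡1)

-- With k = e + 10t, k (2e - k) = e² - 100t² is e² modulo 50.
unitMod50 : ∀ k e w → e * e * w ≡ 1ℤ [mod + 50 ] → k ≡ e [mod + 10 ] →
            (+ 2 * e - k) * w * k ≡ 1ℤ [mod + 50 ]
unitMod50 k e w (divides q e²w-1≡50q) (divides t k-e≡10t) =
  divides (q - + 2 * t * t * w) (begin
    (+ 2 * e - k) * w * k - 1ℤ                     ≡⟨ complete-square e w k ⟩
    (e * e * w - 1ℤ) - (k - e) * (k - e) * w       ≡⟨ cong₂ (λ x y → x - y * y * w) e²w-1≡50q k-e≡10t ⟩
    q * + 50 - (t * + 10) * (t * + 10) * w         ≡⟨ collect q t w ⟩
    (q - + 2 * t * t * w) * + 50                   ∎)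
  where
  open ≡-Reasoning
  complete-square : ∀ e w k → (+ 2 * e - k) * w * k - 1ℤ ≡ (e * e * w - 1ℤ) - (k - e) * (k - e) * w
  complete-square = solve-∀
  collect : ∀ q t w → q * + 50 - (t * + 10) * (t * + 10) * w ≡ (q - + 2 * t * t * w) * + 50
  collect = solve-∀

∣-*⇔mod50 : ∀ k →
  (k ≡ + 1 [mod + 10 ]) ⊎ (k ≡ - (+ 1) [mod + 10 ]) ⊎ (k ≡ + 3 [mod + 10 ]) ⊎ (k ≡ - (+ 3) [mod + 10 ]) →
  ∀ x → + 50 ∣ k * x ⇔ + 50 ∣ x
∣-*⇔mod50 k = λ where
    (inj₁ k≡1)                → by-unit (+ 1)     (+ 1)  (divides (+ 0) refl) k≡1
    (inj₂ (inj₁ k≡-1))        → by-unit (- (+ 1)) (+ 1)  (divides (+ 0) refl) k≡-1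
    -- 39 inverts 9 modulo 50, since 9 · 39 = 351 = 7 · 50 + 1.
    (inj₂ (inj₂ (inj₁ k≡3)))  → by-unit (+ 3)     (+ 39) (divides (+ 7) refl) k≡3
    (inj₂ (inj₂ (inj₂ k≡-3))) → by-unit (- (+ 3)) (+ 39) (divides (+ 7) refl) k≡-3
  where
  by-unit : ∀ e w → e * e * w ≡ 1ℤ [mod + 50 ] → k ≡ e [mod + 10 ] → ∀ x → + 50 ∣ k * x ⇔ + 50 ∣ x
  by-unit e w e²w≡1 k≡e = unit⇒∣-*⇔ ((+ 2 * e - k) * w) k (unitMod50 k e w e²w≡1 k≡e)

-- The numerators of g and f

-- Five times the values of `g` and `f`; 25 is the constant 5 over the denominator 5. All other
-- coefficients are even and are written with the 2 split off: it supplies the factor 10 once 5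
-- divides `b` and `c`, and the parity argument off the diagonal.
diagonal offDiagonal : (r s a b c d : ℤ) → ℤ
diagonal    r s a b c d = + 2 * r * b + + 2 * s * a * b + + 2 * s * c * d
offDiagonal r s a b c d = + 25 + + 2 * r * d + + 2 * s * a * b + + 2 * s * c * d

-- With b = 5b′ and c = 5c′ the difference of the two sides is 10 times a sum whose three terms
-- contain the factors r + 2sε, a - ε and d - ε, each a multiple of 5.
diagonal-mod50 : ∀ r s ε {a b c d} → + 5 ∣ r + + 2 * s * ε →
  a ≡ ε [mod + 5 ] → d ≡ ε [mod + 5 ] → (5∣b : + 5 ∣ b) (5∣c : + 5 ∣ c) →
  diagonal r s a b c d ≡ + 10 * (s * ε * (quotient 5∣c - quotient 5∣b)) [mod + 50 ]
diagonal-mod50 r s ε {a} {d = d} (divides m r+2sε≡5m) (divides a′ a-ε≡5a′) (divides d′ d-ε≡5d′)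
  (divides b′ refl) (divides c′ refl) = divides (m * b′ + s * a′ * b′ + s * c′ * d′) (begin
    diagonal r s a (b′ * + 5) (c′ * + 5) d - + 10 * (s * ε * (c′ - b′))
      ≡⟨ expand r s ε a b′ c′ d ⟩
    + 10 * ((r + + 2 * s * ε) * b′ + s * (a - ε) * b′ + s * c′ * (d - ε))
      ≡⟨ cong₂ (λ x y → + 10 * (x * b′ + s * y * b′ + s * c′ * (d - ε))) r+2sε≡5m a-ε≡5a′ ⟩
    + 10 * (m * + 5 * b′ + s * (a′ * + 5) * b′ + s * c′ * (d - ε))
      ≡⟨ cong (λ x → + 10 * (m * + 5 * b′ + s * (a′ * + 5) * b′ + s * c′ * x)) d-ε≡5d′ ⟩
    + 10 * (m * + 5 * b′ + s * (a′ * + 5) * b′ + s * c′ * (d′ * + 5))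
      ≡⟨ collect m s a′ b′ c′ d′ ⟩
    (m * b′ + s * a′ * b′ + s * c′ * d′) * + 50 ∎)
  where
  open ≡-Reasoning
  expand : ∀ r s ε a b′ c′ d →
    + 2 * r * (b′ * + 5) + + 2 * s * a * (b′ * + 5) + + 2 * s * (c′ * + 5) * d - + 10 * (s * ε * (c′ - b′))
    ≡ + 10 * ((r + + 2 * s * ε) * b′ + s * (a - ε) * b′ + s * c′ * (d - ε))
  expand = solve-∀
  collect : ∀ m s a′ b′ c′ d′ →
    + 10 * (m * + 5 * b′ + s * (a′ * + 5) * b′ + s * c′ * (d′ * + 5))
    ≡ (m * b′ + s * a′ * b′ + s * c′ * d′) * + 50
  collect = solve-∀

50∣10x⇔5∣x : ∀ x → + 50 ∣ + 10 * x ⇔ + 5 ∣ x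
50∣10x⇔5∣x x = mk⇔ (*-cancelˡ-∣ (+ 10) {+ 5} {x}) (*-monoʳ-∣ (+ 10) {+ 5} {x})

∣-swap : ∀ {n} x y → n ∣ x - y → n ∣ y - x
∣-swap {n} x y n∣x-y = subst (n ∣_) (-[x-y]≡y-x x y) (∣m⇒∣-m n∣x-y)
  where
  -[x-y]≡y-x : ∀ x y → - (x - y) ≡ y - x
  -[x-y]≡y-x = solve-∀

-- After the reduction modulo 50, the factor 10 is cancelled and then sε, which is its own inverse
-- modulo 5; what remains is 5 ∣ c′ - b′.
50∣diagonal⇔ : ∀ r s ε {a b c d} → + 5 ∣ r + + 2 * s * ε → (s * ε) * (s * ε) ≡ 1ℤ [mod + 5 ] →
  a ≡ ε [mod + 5 ] → d ≡ ε [mod + 5 ] → (5∣b : + 5 ∣ b) (5∣c : + 5 ∣ c) →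
  + 50 ∣ diagonal r s a b c d ⇔ quotient 5∣b ≡ quotient 5∣c [mod + 5 ]
50∣diagonal⇔ r s ε r≡-2sε sε-unit a≡ε d≡ε 5∣b 5∣c =
  mk⇔ (∣-swap c′ b′) (∣-swap b′ c′)
  ⇔-∘ unit⇒∣-*⇔ (s * ε) (s * ε) sε-unit (c′ - b′)
  ⇔-∘ 50∣10x⇔5∣x (s * ε * (c′ - b′))
  ⇔-∘ ∣-difference⇒⇔ _ (+ 10 * (s * ε * (c′ - b′))) (diagonal-mod50 r s ε r≡-2sε a≡ε d≡ε 5∣b 5∣c)
  where
  b′ c′ : ℤ
  b′ = quotient 5∣b
  c′ = quotient 5∣c

50∤offDiagonal : ∀ r s a b c d → ¬ + 50 ∣ offDiagonal r s a b c d
50∤offDiagonal r s a b c d 50∣N =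
  -- 50 ∣ N gives 2 ∣ N, but N = 1 + 2x, where the 12 in `x` comes from 25 = 1 + 2 · 12.
  from-no (+ 2 ∣? 1ℤ) $ ∣m+n∣n⇒∣m {m = 1ℤ}
    (subst (+ 2 ∣_) (odd r s a b c d) (∣-trans (divides (+ 25) refl) 50∣N)) (∣n⇒∣m*n x ∣-refl)
  where
  x : ℤ
  x = + 12 + r * d + s * a * b + s * c * d
  odd : ∀ r s a b c d → + 25 + + 2 * r * d + + 2 * s * a * b + + 2 * s * c * d ≡
                        1ℤ + (+ 12 + r * d + s * a * b + s * c * d) * + 2
  odd = solve-∀

≡⇒5∤ : ∀ b u → ¬ + 5 ∣ u → b ≡ u [mod + 5 ] → ¬ + 5 ∣ b
≡⇒5∤ b u 5∤u b≡u 5∣b = 5∤u (Equivalence.to (∣-difference⇒⇔ b u b≡u) 5∣b)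

≡0⇒∣ : ∀ {n} x → x ≡ + 0 [mod n ] → n ∣ x
≡0⇒∣ {n} x = subst (n ∣_) (+-identityʳ x)

-- The parameters are halves of the coefficients: `r` of that of b or d, `s` of that of ab and cd.
-- In the class of `-S` the minus sign before the d-term is absorbed into `r`.
numeratorG numeratorF : Γθ5 → ℤ
numeratorG (mat a b c d _ , ≡I  _) = diagonal    (+ 3)   (+ 1) a b c d
numeratorG (mat a b c d _ , ≡-I _) = diagonal    (+ 12)  (+ 1) a b c d
numeratorG (mat a b c d _ , ≡S  _) = offDiagonal (+ 3)   (+ 1) a b c d
numeratorG (mat a b c d _ , ≡-S _) = offDiagonal (- + 3) (+ 1) a b c d
numeratorF (mat a b c d _ , ≡I  _) = diagonal    (+ 2)   (+ 4) a b c d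
numeratorF (mat a b c d _ , ≡-I _) = diagonal    (+ 3)   (+ 4) a b c d
numeratorF (mat a b c d _ , ≡S  _) = offDiagonal (+ 2)   (+ 4) a b c d
numeratorF (mat a b c d _ , ≡-S _) = offDiagonal (- + 2) (+ 4) a b c d

50∣diagonal⇔b/5≡c/5 : ∀ r s ε M → + 5 ∣ r + + 2 * s * ε → (s * ε) * (s * ε) ≡ 1ℤ [mod + 5 ] →
  let open Γθ5 M in
  a ≡ ε [mod + 5 ] → b ≡ + 0 [mod + 5 ] → c ≡ + 0 [mod + 5 ] → d ≡ ε [mod + 5 ] →
  + 50 ∣ diagonal r s a b c d ⇔ b/5≡c/5 M
50∣diagonal⇔b/5≡c/5 r s ε M r≡-2sε sε-unit a≡ε b≡0 c≡0 d≡ε = mk⇔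
  (λ 50∣N → ≡0⇒∣ b b≡0 , ≡0⇒∣ c c≡0 , Equivalence.to (divisible (≡0⇒∣ b b≡0) (≡0⇒∣ c c≡0)) 50∣N)
  (λ (5∣b , 5∣c , b′≡c′) → Equivalence.from (divisible 5∣b 5∣c) b′≡c′)
  where
  open Γθ5 M
  divisible : (5∣b : + 5 ∣ b) (5∣c : + 5 ∣ c) →
              + 50 ∣ diagonal r s a b c d ⇔ quotient 5∣b ≡ quotient 5∣c [mod + 5 ]
  -- Quantified over the proofs of divisibility: the forward direction takes them from the
  -- congruence class of `M`, the converse from the given element of `b/5≡c/5`, and each brings its
  -- own quotients.
  divisible = 50∣diagonal⇔ r s ε r≡-2sε sε-unit a≡ε d≡ε

-- Both sides are false: the left by parity, the right by `5∤b`.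
50∣offDiagonal⇔b/5≡c/5 : ∀ r s M → let open Γθ5 M in
  ¬ + 5 ∣ b → + 50 ∣ offDiagonal r s a b c d ⇔ b/5≡c/5 M
50∣offDiagonal⇔b/5≡c/5 r s M 5∤b = mk⇔
  (λ 50∣N → contradiction 50∣N (50∤offDiagonal r s a b c d))
  (λ (5∣b , _) → contradiction 5∣b 5∤b)
  where open Γθ5 M

5∤1 : ¬ + 5 ∣ 1ℤ
5∤1 = from-no (+ 5 ∣? 1ℤ)

5∤-1 : ¬ + 5 ∣ -1ℤ
5∤-1 = from-no (+ 5 ∣? -1ℤ)

50∣numeratorG⇔ : ∀ M → + 50 ∣ numeratorG M ⇔ b/5≡c/5 M
50∣numeratorG⇔ M@(mat _ _ _ _ _ , ≡I (a≡1 , b≡0 , c≡0 , d≡1)) =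
  -- The witnesses are r + 2sε = 3 + 2 = 1 · 5 here and 12 - 2 = 2 · 5 for `-I`; (sε)² is exactly 1.
  50∣diagonal⇔b/5≡c/5 (+ 3) (+ 1) 1ℤ M (divides (+ 1) refl) (divides (+ 0) refl) a≡1 b≡0 c≡0 d≡1
50∣numeratorG⇔ M@(mat _ _ _ _ _ , ≡-I (a≡-1 , b≡0 , c≡0 , d≡-1)) =
  50∣diagonal⇔b/5≡c/5 (+ 12) (+ 1) -1ℤ M (divides (+ 2) refl) (divides (+ 0) refl) a≡-1 b≡0 c≡0 d≡-1
50∣numeratorG⇔ M@(mat _ b _ _ _ , ≡S (_ , b≡-1 , _)) =
  50∣offDiagonal⇔b/5≡c/5 (+ 3) (+ 1) M (≡⇒5∤ b -1ℤ 5∤-1 b≡-1)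
50∣numeratorG⇔ M@(mat _ b _ _ _ , ≡-S (_ , b≡1 , _)) =
  50∣offDiagonal⇔b/5≡c/5 (- + 3) (+ 1) M (≡⇒5∤ b 1ℤ 5∤1 b≡1)

50∣numeratorF⇔ : ∀ M → + 50 ∣ numeratorF M ⇔ b/5≡c/5 M
50∣numeratorF⇔ M@(mat _ _ _ _ _ , ≡I (a≡1 , b≡0 , c≡0 , d≡1)) =
  -- Here r + 2sε is 2 + 8 = 2 · 5, and 3 - 8 = -1 · 5 for `-I`; (sε)² - 1 = 15 = 3 · 5.
  50∣diagonal⇔b/5≡c/5 (+ 2) (+ 4) 1ℤ M (divides (+ 2) refl) (divides (+ 3) refl) a≡1 b≡0 c≡0 d≡1
50∣numeratorF⇔ M@(mat _ _ _ _ _ , ≡-I (a≡-1 , b≡0 , c≡0 , d≡-1)) =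
  50∣diagonal⇔b/5≡c/5 (+ 3) (+ 4) -1ℤ M (divides -1ℤ refl) (divides (+ 3) refl) a≡-1 b≡0 c≡0 d≡-1
50∣numeratorF⇔ M@(mat _ b _ _ _ , ≡S (_ , b≡-1 , _)) =
  50∣offDiagonal⇔b/5≡c/5 (+ 2) (+ 4) M (≡⇒5∤ b -1ℤ 5∤-1 b≡-1)
50∣numeratorF⇔ M@(mat _ b _ _ _ , ≡-S (_ , b≡1 , _)) =
  50∣offDiagonal⇔b/5≡c/5 (- + 2) (+ 4) M (≡⇒5∤ b 1ℤ 5∤1 b≡1)

-- Normalised fractions

-- Identities between normalised fractions are reduced to cross multiplication of unnormalised ones.
-- This applies because `x / 5` is definitionally `fromℚᵘ (mkℚᵘ x 4)`, where 4 is the denominator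
-- minus one.
toℚᵘ⇒≡fromℚᵘ : ∀ {p q} → ℚ.toℚᵘ p ℚᵘ.≃ q → p ≡ ℚ.fromℚᵘ q
toℚᵘ⇒≡fromℚᵘ {p} p≃q = trans (sym (ℚ.fromℚᵘ-toℚᵘ p)) (ℚ.fromℚᵘ-cong p≃q)

fromℚᵘ-homo-+ : ∀ p q → ℚ.fromℚᵘ p ℚ.+ ℚ.fromℚᵘ q ≡ ℚ.fromℚᵘ (p ℚᵘ.+ q)
fromℚᵘ-homo-+ p q = toℚᵘ⇒≡fromℚᵘ $ ℚᵘ.≃-trans
  (ℚ.toℚᵘ-homo-+ (ℚ.fromℚᵘ p) (ℚ.fromℚᵘ q)) (ℚᵘ.+-cong (ℚ.toℚᵘ-fromℚᵘ p) (ℚ.toℚᵘ-fromℚᵘ q))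

fromℚᵘ-homo-* : ∀ p q → ℚ.fromℚᵘ p ℚ.* ℚ.fromℚᵘ q ≡ ℚ.fromℚᵘ (p ℚᵘ.* q)
fromℚᵘ-homo-* p q = toℚᵘ⇒≡fromℚᵘ $ ℚᵘ.≃-trans
  (ℚ.toℚᵘ-homo-* (ℚ.fromℚᵘ p) (ℚ.fromℚᵘ q)) (ℚᵘ.*-cong (ℚ.toℚᵘ-fromℚᵘ p) (ℚ.toℚᵘ-fromℚᵘ q))

fromℚᵘ-homo-neg : ∀ p → ℚ.- ℚ.fromℚᵘ p ≡ ℚ.fromℚᵘ (ℚᵘ.- p)
fromℚᵘ-homo-neg p = toℚᵘ⇒≡fromℚᵘ $ ℚᵘ.≃-trans
  (ℚ.toℚᵘ-homo‿- (ℚ.fromℚᵘ p)) (ℚᵘ.-‿cong (ℚ.toℚᵘ-fromℚᵘ p))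

x/5+y/5 : ∀ x y → x / 5 ℚ.+ y / 5 ≡ (x + y) / 5
x/5+y/5 x y = trans (fromℚᵘ-homo-+ (mkℚᵘ x 4) (mkℚᵘ y 4))
  (ℚ.fromℚᵘ-cong {mkℚᵘ x 4 ℚᵘ.+ mkℚᵘ y 4} {mkℚᵘ (x + y) 4} (*≡* (cross x y)))
  where
  cross : ∀ x y → (x * + 5 + y * + 5) * + 5 ≡ (x + y) * + 25
  cross = solve-∀

5+x/5 : ∀ x → + 5 / 1 ℚ.+ x / 5 ≡ (+ 25 + x) / 5
-- `+ 25 / 5` and `+ 5 / 1` compute to the same normalised fraction.
5+x/5 x = x/5+y/5 (+ 25) x

5-x/5 : ∀ r d → + 5 / 1 ℚ.- (+ 2 * r * d) / 5 ≡ (+ 25 + + 2 * (- r) * d) / 5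
5-x/5 r d = begin
  + 5 / 1 ℚ.- (+ 2 * r * d) / 5     ≡⟨ cong (+ 5 / 1 ℚ.+_) (fromℚᵘ-homo-neg (mkℚᵘ (+ 2 * r * d) 4)) ⟩
  + 5 / 1 ℚ.+ (- (+ 2 * r * d)) / 5 ≡⟨ 5+x/5 (- (+ 2 * r * d)) ⟩
  (+ 25 + - (+ 2 * r * d)) / 5      ≡⟨ cong (λ x → (+ 25 + x) / 5) (neg-middle r d) ⟩
  (+ 25 + + 2 * (- r) * d) / 5      ∎
  where
  open ≡-Reasoning
  neg-middle : ∀ r d → - (+ 2 * r * d) ≡ + 2 * (- r) * d
  neg-middle = solve-∀

-- The first summand `q` is kept general to cover both a single fraction and 5 plus or minus a
-- fraction.
sum/5 : ∀ {q} x y z → q ≡ x / 5 → q ℚ.+ y / 5 ℚ.+ z / 5 ≡ (x + y + z) / 5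
sum/5 x y z refl = trans (cong (ℚ._+ z / 5) (x/5+y/5 x y)) (x/5+y/5 (x + y) z)

g≡numeratorG/5 : ∀ M → g M ≡ numeratorG M / 5
g≡numeratorG/5 (mat a b c d _ , ≡I  _) = sum/5 (+ 6 * b) (+ 2 * a * b) (+ 2 * c * d) refl
g≡numeratorG/5 (mat a b c d _ , ≡-I _) = sum/5 (+ 24 * b) (+ 2 * a * b) (+ 2 * c * d) refl
g≡numeratorG/5 (mat a b c d _ , ≡S  _) = sum/5 (+ 25 + + 6 * d) (+ 2 * a * b) (+ 2 * c * d) (5+x/5 (+ 6 * d))
g≡numeratorG/5 (mat a b c d _ , ≡-S _) = sum/5 (+ 25 + + 2 * (- + 3) * d) (+ 2 * a * b) (+ 2 * c * d) (5-x/5 (+ 3) d)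

f≡numeratorF/5 : ∀ M → f M ≡ numeratorF M / 5
f≡numeratorF/5 (mat a b c d _ , ≡I  _) = sum/5 (+ 4 * b) (+ 8 * a * b) (+ 8 * c * d) refl
f≡numeratorF/5 (mat a b c d _ , ≡-I _) = sum/5 (+ 6 * b) (+ 8 * a * b) (+ 8 * c * d) refl
f≡numeratorF/5 (mat a b c d _ , ≡S  _) = sum/5 (+ 25 + + 4 * d) (+ 8 * a * b) (+ 8 * c * d) (5+x/5 (+ 4 * d))
f≡numeratorF/5 (mat a b c d _ , ≡-S _) = sum/5 (+ 25 + + 2 * (- + 2) * d) (+ 8 * a * b) (+ 8 * c * d) (5-x/5 (+ 2) d)

-- The product is kN/25, and kN/25 = 2n clears to kN = 50n with the same `n` on both sides.
k/5*N/5-even⇔50∣kN : ∀ k N → (∃[ n ] (k / 5) ℚ.* (N / 5) ≡ (+ 2 * n) / 1) ⇔ + 50 ∣ k * N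
k/5*N/5-even⇔50∣kN k N = mk⇔
  (λ (n , eq) → divides n (begin
    k * N            ≡⟨ *-identityʳ (k * N) ⟨
    k * N * + 1      ≡⟨ ℚᵘ.drop-*≡* (ℚ.fromℚᵘ-injective {mkℚᵘ (k * N) 24} {mkℚᵘ (+ 2 * n) 0} (trans (sym kN/25) eq)) ⟩
    + 2 * n * + 25   ≡⟨ 2n*25 n ⟩
    n * + 50         ∎))
  (λ (divides n kN≡50n) → n , trans kN/25 (ℚ.fromℚᵘ-cong {mkℚᵘ (k * N) 24} {mkℚᵘ (+ 2 * n) 0} (*≡* (begin
    k * N * + 1      ≡⟨ *-identityʳ (k * N) ⟩
    k * N            ≡⟨ kN≡50n ⟩
    n * + 50         ≡⟨ 2n*25 n ⟨
    + 2 * n * + 25   ∎))))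
  where
  open ≡-Reasoning
  kN/25 : (k / 5) ℚ.* (N / 5) ≡ (k * N) / 25
  kN/25 = fromℚᵘ-homo-* (mkℚᵘ k 4) (mkℚᵘ N 4)
  2n*25 : ∀ n → + 2 * n * + 25 ≡ n * + 50
  2n*25 = solve-∀

-- The exponential

module _ {c ℓ₁ ℓ₂} (ℂ : ComplexExponential c ℓ₁ ℓ₂) where
  open ComplexExponential ℂ
    hiding (_+_; +-identityʳ; *-identityʳ; refl)
    renaming (_*_ to _*ᶜ_; -_ to -ᶜ_; _-_ to _-ᶜ_; sym to ≈-sym; trans to ≈-trans
             ; *-comm to *ᶜ-comm)
  open CommutativeRing commutativeRing using (ring)
  open HeytingProperties heytingCommutativeRing using (x-0≈x; x#0y#0→xy#0; invertibleˡ⇒#)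
  open RingProperties ring using (-‿distribˡ-*; -‿involutive)
  open IsRingMonomorphism ι-isRingMonomorphism using (injective; *-homo; ⟦⟧-cong)
  open Multiplier ℂ
  open SetoidReasoning setoid

  i#0 : i # 0#
  i#0 = invertibleˡ⇒# (-ᶜ i , (begin
    -- Apartness from 0 amounts to invertibility of the difference with 0; the inverse of `i` is its
    -- negative.
    -ᶜ i *ᶜ (i -ᶜ 0#)  ≈⟨ *-congˡ (x-0≈x i) ⟩
    -ᶜ i *ᶜ i          ≈⟨ -‿distribˡ-* i i ⟨
    -ᶜ (i *ᶜ i)        ≈⟨ -‿cong i²≈-1 ⟩
    -ᶜ (-ᶜ 1#)         ≈⟨ -‿involutive 1# ⟩
    1#                 ∎))

  *-cancelˡ-#0 : ∀ {x y z} → x # 0# → x *ᶜ y ≈ x *ᶜ z → y ≈ z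
  *-cancelˡ-#0 {x} {y} {z} x#0 xy≈xz with #⇒invertible x#0
  ... | w , w[x-0]≈1 , _ = begin
    y                ≈⟨ w[xt]≈t y ⟨
    w *ᶜ (x *ᶜ y)    ≈⟨ *-congˡ xy≈xz ⟩
    w *ᶜ (x *ᶜ z)    ≈⟨ w[xt]≈t z ⟩
    z                ∎
    where
    w[xt]≈t : ∀ t → w *ᶜ (x *ᶜ t) ≈ t
    w[xt]≈t t = begin
      w *ᶜ (x *ᶜ t)          ≈⟨ *-assoc w x t ⟨
      w *ᶜ x *ᶜ t            ≈⟨ *-congʳ (*-congˡ (x-0≈x x)) ⟨
      w *ᶜ (x -ᶜ 0#) *ᶜ t    ≈⟨ *-congʳ w[x-0]≈1 ⟩
      1# *ᶜ t                ≈⟨ *-identityˡ t ⟩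
      t                      ∎

  -- Both π and i are apart from 0, so πi cancels, and injectivity of `ι` brings the remaining
  -- equation down to ℚ.
  πi*x*y≈z*πi⇔ : ∀ x y z → (π *ᶜ i *ᶜ ι x *ᶜ ι y ≈ ι z *ᶜ (π *ᶜ i)) ⇔ x ℚ.* y ≡ z
  πi*x*y≈z*πi⇔ x y z = mk⇔
    (λ eq → injective (*-cancelˡ-#0 (x#0y#0→xy#0 π#0 i#0) (begin
      π *ᶜ i *ᶜ ι (x ℚ.* y)      ≈⟨ πi*xy ⟨
      π *ᶜ i *ᶜ ι x *ᶜ ι y       ≈⟨ eq ⟩
      ι z *ᶜ (π *ᶜ i)            ≈⟨ *ᶜ-comm (ι z) (π *ᶜ i) ⟩
      π *ᶜ i *ᶜ ι z              ∎)))
    (λ xy≡z → begin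
      π *ᶜ i *ᶜ ι x *ᶜ ι y       ≈⟨ πi*xy ⟩
      π *ᶜ i *ᶜ ι (x ℚ.* y)      ≈⟨ *-congˡ (⟦⟧-cong xy≡z) ⟩
      π *ᶜ i *ᶜ ι z              ≈⟨ *ᶜ-comm (π *ᶜ i) (ι z) ⟩
      ι z *ᶜ (π *ᶜ i)            ∎)
    where
    πi*xy : π *ᶜ i *ᶜ ι x *ᶜ ι y ≈ π *ᶜ i *ᶜ ι (x ℚ.* y)
    πi*xy = ≈-trans (*-assoc (π *ᶜ i) (ι x) (ι y)) (*-congˡ (≈-sym (*-homo x y)))

  exp≈1⇔50∣kN : ∀ k {q} N → q ≡ N / 5 → (exp (π *ᶜ i *ᶜ ι (k / 5) *ᶜ ι q) ≈ 1#) ⇔ + 50 ∣ k * N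
  exp≈1⇔50∣kN k N refl =
    -- Read from the last line up: the kernel of `exp` gives a multiple of 2πi, πi is cancelled for
    -- each `n`, and the denominators are cleared.
    k/5*N/5-even⇔50∣kN k N
    ⇔-∘ mk⇔ (λ (n , eq) → n , Equivalence.to (πi*x*y≈z*πi⇔ _ _ _) eq)
            (λ (n , eq) → n , Equivalence.from (πi*x*y≈z*πi⇔ _ _ _) eq)
    ⇔-∘ exp≈1⇔ _

  module _ (k : ℤ) (50∣k*⇔ : ∀ x → + 50 ∣ k * x ⇔ + 50 ∣ x) where

    -- The condition on `k` enters only as the cancellation `50∣k*⇔`, so both kernels reduce to the
    -- same predicate, independent of `k`.
    KerνG⇔ : ∀ M → Ker (νG^ k) M ⇔ b/5≡c/5 M
    KerνG⇔ M = 50∣numeratorG⇔ M ⇔-∘ 50∣k*⇔ _ ⇔-∘ exp≈1⇔50∣kN k (numeratorG M) (g≡numeratorG/5 M)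

    KerνF⇔ : ∀ M → Ker (νF^ k) M ⇔ b/5≡c/5 M
    KerνF⇔ M = 50∣numeratorF⇔ M ⇔-∘ 50∣k*⇔ _ ⇔-∘ exp≈1⇔50∣kN k (numeratorF M) (f≡numeratorF/5 M)

pointwise⇒≐ : ∀ {a ℓ₁ ℓ₂} {A : Set a} {P : Pred A ℓ₁} {Q : Pred A ℓ₂} → (∀ x → P x ⇔ Q x) → P ≐ Q
pointwise⇒≐ P⇔Q = (λ {x} → Equivalence.to (P⇔Q x)) , (λ {x} → Equivalence.from (P⇔Q x))

mainTheorem11 : ∀ {c ℓ₁ ℓ₂} (ℂ : ComplexExponential c ℓ₁ ℓ₂) → let open Multiplier ℂ in
    (k : ℤ) →
    (k ≡ + 1 [mod + 10 ]) ⊎ (k ≡ - (+ 1) [mod + 10 ]) ⊎ (k ≡ + 3 [mod + 10 ]) ⊎ (k ≡ - (+ 3) [mod + 10 ]) →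
    (Ker (νG^ k) ≐ b/5≡c/5) × (Ker (νG^ k) ≐ Ker (νF^ k))
mainTheorem11 ℂ k k≡ =
    pointwise⇒≐ (KerνG⇔ ℂ k (∣-*⇔mod50 k k≡))
  , pointwise⇒≐ (λ M → ⇔-sym (KerνF⇔ ℂ k (∣-*⇔mod50 k k≡) M) ⇔-∘ KerνG⇔ ℂ k (∣-*⇔mod50 k k≡) M)
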